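{- Let $D_{(=,\geq)}(x)$ be the generating function, with respect to the length, for the total number of descents over all Catalan words avoiding the ordered pair of relations $(=,\geq)$. Then $$D_{(=,\geq)}(x)=\frac{1 - 2 x - 3 x^2 + x^4 -(1-x-x^2) \sqrt{1 - 2 x - 5 x^2 - 2 x^3 + x^4}}{2 x\sqrt{1 - 2 x - 5 x^2 - 2 x^3 + x^4}}.$$
   Context: A Catalan word of length $n$ is a word $w=w_1w_2\cdots w_n$ over the non-negative integers with $w_1=0$ and $0\leq w_i\leq w_{i-1}+1$ for $i=2,\dots,n$; the empty word is the unique Catalan word of length $0$. For relations $X,Y\in\{<,>,\leq,\geq,=,\neq\}$, a word $w$ contains the pattern $(X,Y)$ if there is an index $i\geq 1$ (with $i+2\le n$) such that $w_i\,X\,w_{i+1}$ and $w_{i+1}\,Y\,w_{i+2}$; otherwise $w$ avoids $(X,Y)$. The number of descents $\mathrm{des}(w)$ is the number of indices $i$ with $w_i>w_{i+1}$. With $C_{(X,Y)}(x,y)=\sum_{w}x^{|w|}y^{\mathrm{des}(w)}$, the sum being over all Catalan words $w$ (of any length $|w|\ge 0$) avoiding $(X,Y)$, one sets $D_{(X,Y)}(x)=\left.\frac{\partial C_{(X,Y)}(x,y)}{\partial y}\right|_{y=1}=\sum_w \mathrm{des}(w)\,x^{|w|}$. Identities are between formal power series in $x$ (after clearing denominators); the square root of a power series with constant term $1$ is the one with constant term $1$. -}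

module Defs where

open import Data.Bool using (if_then_else_; true; false; T)
open import Data.Fin using (Fin; toℕ; inject₁; fromℕ)
open import Data.Fin.Properties using (toℕ-inject₁; toℕ-fromℕ; toℕ<n)
open import Data.Integer using (+_)
open import Data.List using (List; []; _∷_; length; map; concatMap; filter; upTo)
open import Data.Nat.ListAction using (sum)
open import Data.List.Membership.Propositional using (_∈_; find; lose)
open import Data.List.Membership.Propositional.Properties
  using (∈-map⁺; ∈-map⁻; ∈-concatMap⁺; ∈-concatMap⁻; ∈-upTo⁺; ∈-upTo⁻)
open import Data.List.Properties using (∷-injectiveˡ; ∷-injectiveʳ)
import Data.List.Relation.Unary.All as All
import Data.List.Relation.Unary.All.Properties as All
import Data.List.Relation.Unary.AllPairs as AllPairs
import Data.List.Relation.Unary.AllPairs.Properties as AllPairs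
open import Data.List.Relation.Unary.Any using (here)
open import Data.List.Relation.Unary.Linked using (Linked; [-]; _∷_)
open import Data.List.Relation.Unary.Unique.Propositional using (Unique)
open import Data.List.Relation.Unary.Unique.Propositional.Properties using (map⁺; concat⁺; upTo⁺)
open import Data.Nat using (ℕ; zero; suc; _∸_; _≤_; _<_; _≡ᵇ_; _<ᵇ_; z≤n; s≤s; s≤s⁻¹)
import Data.Nat as ℕ
import Data.Nat.Properties as ℕ
open import Data.Product using (_×_; _,_)
open import Data.Rational as ℚ using (ℚ; 0ℚ; 1ℚ; ½; _/_)
import Data.Rational.Properties as ℚ
open import Algebra.Bundles using (CommutativeRing)
open import Algebra.Properties.Semiring.Sum (CommutativeRing.semiring ℚ.+-*-commutativeRing)
  using (sum-syntax; sum⁺-syntax; sum-cong-≗; sum-init-last)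
open import Data.Sum using (inj₁; inj₂; [_,_]′)
open import Data.Unit using (⊤; tt)
open import Function using (_∘_; _⇔_; mk⇔)
open import Level using (0ℓ)
open import Relation.Binary using (Rel; Decidable)
open import Relation.Binary.PropositionalEquality
open import Relation.Nullary using (¬_; no; ¬?; contradiction)
open import Relation.Nullary.Decidable using (map′; _×-dec_; _⊎-dec_)
import Relation.Unary as Unary

Word : Set
Word = List ℕ

IsCatalan : Word → Set
IsCatalan []      = ⊤
IsCatalan (a ∷ w) = a ≡ 0 × Linked (λ b c → c ≤ suc b) (a ∷ w)

data Contains (X Y : Rel ℕ 0ℓ) : Word → Set where
  here  : ∀ {a b c w} → X a b → Y b c → Contains X Y (a ∷ b ∷ c ∷ w)
  there : ∀ {a w} → Contains X Y w → Contains X Y (a ∷ w)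

Avoids : (X Y : Rel ℕ 0ℓ) → Word → Set
Avoids X Y w = ¬ Contains X Y w

contains? : ∀ {X Y} → Decidable X → Decidable Y → Unary.Decidable (Contains X Y)
contains? X? Y? []              = no λ ()
contains? X? Y? (a ∷ [])        = no λ { (there ()) }
contains? X? Y? (a ∷ b ∷ [])    = no λ { (there (there ())) }
contains? X? Y? (a ∷ b ∷ c ∷ w) =
  map′ [ (λ { (x , y) → here x y }) , there ]′
       (λ { (here x y) → inj₁ (x , y) ; (there p) → inj₂ p })
       ((X? a b ×-dec Y? b c) ⊎-dec contains? X? Y? (b ∷ c ∷ w))

avoids? : ∀ {X Y} → Decidable X → Decidable Y → Unary.Decidable (Avoids X Y)
avoids? X? Y? w = ¬? (contains? X? Y? w)

des : Word → ℕ
des []          = 0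
des (a ∷ [])    = 0
des (a ∷ b ∷ w) = (if b <ᵇ a then 1 else 0) ℕ.+ des (b ∷ w)

-- extensions a n lists the words v of length n for which every letter of
-- a ∷ v exceeds its predecessor by at most 1.
extensions : ℕ → ℕ → List Word
extensions a zero    = [] ∷ []
extensions a (suc n) = concatMap (λ b → map (b ∷_) (extensions b n)) (upTo (2 ℕ.+ a))

-- The Catalan words of length n, each listed exactly once; this is what
-- ∈-catalanWords and catalanWords-unique establish.
catalanWords : ℕ → List Word
catalanWords zero    = [] ∷ []
catalanWords (suc n) = map (0 ∷_) (extensions 0 n)

private
  ext⁻ : ∀ a n {v} → v ∈ extensions a n → Linked (λ b c → c ≤ suc b) (a ∷ v) × length v ≡ n
  ext⁻ a zero (here refl) = [-] , refl
  ext⁻ a (suc n) v∈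
    with b , b∈ , v∈b ← find (∈-concatMap⁻ (λ b → map (b ∷_) (extensions b n)) {upTo (2 ℕ.+ a)} v∈)
    with u , u∈ , refl ← ∈-map⁻ (b ∷_) v∈b
    with l , e ← ext⁻ b n u∈ = s≤s⁻¹ (∈-upTo⁻ b∈) ∷ l , cong suc e

  ext⁺ : ∀ a n {v} → Linked (λ b c → c ≤ suc b) (a ∷ v) → length v ≡ n → v ∈ extensions a n
  ext⁺ a zero {[]} l e = here refl
  ext⁺ a (suc n) {b ∷ v} (b≤ ∷ l) e =
    ∈-concatMap⁺ (λ b → map (b ∷_) (extensions b n))
      (lose (∈-upTo⁺ (s≤s b≤)) (∈-map⁺ (b ∷_) (ext⁺ b n l (ℕ.suc-injective e))))

  ext-unique : ∀ a n → Unique (extensions a n)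
  ext-unique a zero    = All.[] AllPairs.∷ AllPairs.[]
  ext-unique a (suc n) = concat⁺
    (All.map⁺ (All.universal (λ b → map⁺ ∷-injectiveʳ (ext-unique b n)) (upTo (2 ℕ.+ a))))
    (AllPairs.map⁺ (AllPairs.map disjoint (upTo⁺ (2 ℕ.+ a))))
    where
    disjoint : ∀ {b c} → b ≢ c → ∀ {v} →
               ¬ (v ∈ map (b ∷_) (extensions b n) × v ∈ map (c ∷_) (extensions c n))
    disjoint b≢c (v∈ , v∈′)
      with _ , _ , e  ← ∈-map⁻ _ v∈
      with _ , _ , e′ ← ∈-map⁻ _ v∈′ = b≢c (∷-injectiveˡ (trans (sym e) e′))

∈-catalanWords : ∀ n w → w ∈ catalanWords n ⇔ (IsCatalan w × length w ≡ n)
∈-catalanWords n w = mk⇔ (to n) (from n w)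
  where
  to : ∀ n {w} → w ∈ catalanWords n → IsCatalan w × length w ≡ n
  to zero    (here refl) = tt , refl
  to (suc n) w∈
    with v , v∈ , refl ← ∈-map⁻ (0 ∷_) w∈
    with l , e ← ext⁻ 0 n v∈ = (refl , l) , cong suc e

  from : ∀ n w → IsCatalan w × length w ≡ n → w ∈ catalanWords n
  from zero    []      _                = here refl
  from (suc n) (_ ∷ w) ((refl , l) , e) = ∈-map⁺ (0 ∷_) (ext⁺ 0 n l (ℕ.suc-injective e))

catalanWords-unique : ∀ n → Unique (catalanWords n)
catalanWords-unique zero    = All.[] AllPairs.∷ AllPairs.[]
catalanWords-unique (suc n) = map⁺ ∷-injectiveʳ (ext-unique 0 n)

-- f n is the coefficient of xⁿ; equality of power series is _≗_.
PowerSeries : Set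
PowerSeries = ℕ → ℚ

infixl 6 _+_ _-_
infixl 7 _*_
infixr 8 _•_
infixr 9 _^_

fromℕℚ : ℕ → ℚ
fromℕℚ k = + k / 1

1ₛ : PowerSeries
1ₛ zero    = 1ℚ
1ₛ (suc _) = 0ℚ

x : PowerSeries
x zero          = 0ℚ
x (suc zero)    = 1ℚ
x (suc (suc _)) = 0ℚ

_+_ _-_ _*_ : PowerSeries → PowerSeries → PowerSeries
(f + g) n = f n ℚ.+ g n
(f - g) n = f n ℚ.- g n
(f * g) n = ∑[ i ≤ n ] (f (toℕ i) ℚ.* g (n ∸ toℕ i))

_•_ : ℕ → PowerSeries → PowerSeries
(k • f) n = fromℕℚ k ℚ.* f n

_^_ : PowerSeries → ℕ → PowerSeries
f ^ zero  = 1ₛ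
f ^ suc k = f * f ^ k

-- sqrtApprox f n is the polynomial of degree at most n and constant term 1
-- whose square agrees with f up to degree n (for f with constant term 1): the
-- coefficient s of xⁿ⁺¹ added at each step solves 2s + [xⁿ⁺¹](previous)² = [xⁿ⁺¹] f.
sqrtApprox : PowerSeries → ℕ → PowerSeries
sqrtApprox f zero    = 1ₛ
sqrtApprox f (suc n) m =
  if m ≡ᵇ suc n
  then ½ ℚ.* (f m ℚ.- (sqrtApprox f n * sqrtApprox f n) m)
  else sqrtApprox f n m

-- The square root with constant term 1, of a series with constant term 1;
-- sqrt-constant and sqrt-square give its characterisation.
sqrt : PowerSeries → PowerSeries
sqrt f n = sqrtApprox f n n

sqrt-constant : ∀ f → sqrt f 0 ≡ 1ℚ
sqrt-constant f = refl

private
  ≡ᵇ-refl : ∀ n → (n ≡ᵇ n) ≡ true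
  ≡ᵇ-refl zero    = refl
  ≡ᵇ-refl (suc n) = ≡ᵇ-refl n

  ≢⇒≡ᵇ : ∀ {m n} → m ≢ n → (m ≡ᵇ n) ≡ false
  ≢⇒≡ᵇ {m} {n} m≢n with m ≡ᵇ n in eq
  ... | true  = contradiction (ℕ.≡ᵇ⇒≡ m n (subst T (sym eq) tt)) m≢n
  ... | false = refl

  approx-new : ∀ f n → sqrt f (suc n) ≡
               ½ ℚ.* (f (suc n) ℚ.- (sqrtApprox f n * sqrtApprox f n) (suc n))
  approx-new f n rewrite ≡ᵇ-refl n = refl

  approx-old : ∀ f n {m} → m ≢ suc n → sqrtApprox f (suc n) m ≡ sqrtApprox f n m
  approx-old f n m≢ rewrite ≢⇒≡ᵇ m≢ = refl

  approx-low : ∀ f n {m} → m ≤ n → sqrtApprox f n m ≡ sqrt f m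
  approx-low f zero    z≤n = refl
  approx-low f (suc n) m≤ with ℕ.m≤n⇒m<n∨m≡n m≤
  ... | inj₁ m<   = trans (approx-old f n (ℕ.<⇒≢ m<)) (approx-low f n (s≤s⁻¹ m<))
  ... | inj₂ refl = refl

  approx-high : ∀ f n {m} → n < m → sqrtApprox f n m ≡ 0ℚ
  approx-high f zero    (s≤s _) = refl
  approx-high f (suc n) n<m =
    trans (approx-old f n (ℕ.>⇒≢ n<m)) (approx-high f n (ℕ.<-trans (ℕ.n<1+n n) n<m))

  middle : PowerSeries → ℕ → ℚ
  middle s n = ∑[ i < n ] (s (suc (toℕ i)) ℚ.* s (n ∸ toℕ i))

  square-split : ∀ s n → (s * s) (suc n) ≡
                 s 0 ℚ.* s (suc n) ℚ.+ (middle s n ℚ.+ s (suc n) ℚ.* s 0)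
  square-split s n = cong (s 0 ℚ.* s (suc n) ℚ.+_) (trans
    (sum-init-last (λ (i : Fin (suc n)) → s (suc (toℕ i)) ℚ.* s (n ∸ toℕ i)))
    (cong₂ ℚ._+_
      (sum-cong-≗ {n} λ i → cong (λ k → s (suc k) ℚ.* s (n ∸ k)) (toℕ-inject₁ i))
      (trans (cong (λ k → s (suc k) ℚ.* s (n ∸ k)) (toℕ-fromℕ n))
             (cong (λ k → s (suc n) ℚ.* s k) (ℕ.n∸n≡0 n)))))

  approx-square : ∀ f n → (sqrtApprox f n * sqrtApprox f n) (suc n) ≡ middle (sqrt f) n
  approx-square f n = begin
    (A * A) (suc n)
      ≡⟨ square-split A n ⟩
    A 0 ℚ.* A (suc n) ℚ.+ (middle A n ℚ.+ A (suc n) ℚ.* A 0)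
      ≡⟨ cong (λ z → A 0 ℚ.* z ℚ.+ (middle A n ℚ.+ z ℚ.* A 0)) (approx-high f n ℕ.≤-refl) ⟩
    A 0 ℚ.* 0ℚ ℚ.+ (middle A n ℚ.+ 0ℚ ℚ.* A 0)
      ≡⟨ cong₂ (λ y z → y ℚ.+ (middle A n ℚ.+ z)) (ℚ.*-zeroʳ (A 0)) (ℚ.*-zeroˡ (A 0)) ⟩
    0ℚ ℚ.+ (middle A n ℚ.+ 0ℚ)
      ≡⟨ trans (ℚ.+-identityˡ _) (ℚ.+-identityʳ _) ⟩
    middle A n
      ≡⟨ sum-cong-≗ {n} (λ i → cong₂ ℚ._*_ (approx-low f n (toℕ<n i))
                                           (approx-low f n (ℕ.m∸n≤m n (toℕ i)))) ⟩
    middle (sqrt f) n ∎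
    where
    open ≡-Reasoning
    A = sqrtApprox f n

sqrt-square : ∀ f → f 0 ≡ 1ℚ → sqrt f * sqrt f ≗ f
sqrt-square f f₀≡1 zero    = sym f₀≡1
sqrt-square f f₀≡1 (suc n) = begin
  (sqrt f * sqrt f) (suc n)         ≡⟨ square-split (sqrt f) n ⟩
  1ℚ ℚ.* s ℚ.+ (M ℚ.+ s ℚ.* 1ℚ)     ≡⟨ cong₂ (λ y z → y ℚ.+ (M ℚ.+ z)) (ℚ.*-identityˡ s) (ℚ.*-identityʳ s) ⟩
  s ℚ.+ (M ℚ.+ s)                   ≡⟨ cong (s ℚ.+_) (ℚ.+-comm M s) ⟩
  s ℚ.+ (s ℚ.+ M)                   ≡⟨ ℚ.+-assoc s s M ⟨
  s ℚ.+ s ℚ.+ M                     ≡⟨ cong (ℚ._+ M) (cong₂ ℚ._+_ s≡ s≡) ⟩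
  ½ ℚ.* d ℚ.+ ½ ℚ.* d ℚ.+ M         ≡⟨ cong (ℚ._+ M) (ℚ.*-distribʳ-+ d ½ ½) ⟨
  1ℚ ℚ.* d ℚ.+ M                    ≡⟨ cong (ℚ._+ M) (ℚ.*-identityˡ d) ⟩
  f (suc n) ℚ.- M ℚ.+ M             ≡⟨ ℚ.+-assoc (f (suc n)) (ℚ.- M) M ⟩
  f (suc n) ℚ.+ (ℚ.- M ℚ.+ M)       ≡⟨ cong (f (suc n) ℚ.+_) (ℚ.+-inverseˡ M) ⟩
  f (suc n) ℚ.+ 0ℚ                  ≡⟨ ℚ.+-identityʳ _ ⟩
  f (suc n) ∎
  where
  open ≡-Reasoning
  s = sqrt f (suc n)
  M = middle (sqrt f) n
  d = f (suc n) ℚ.- M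
  s≡ : s ≡ ½ ℚ.* d
  s≡ = trans (approx-new f n) (cong (λ z → ½ ℚ.* (f (suc n) ℚ.- z)) (approx-square f n))

totalDescents : ∀ {X Y} → Decidable X → Decidable Y → ℕ → ℕ
totalDescents X? Y? n = sum (map des (filter (avoids? X? Y?) (catalanWords n)))

D : ∀ {X Y} → Decidable X → Decidable Y → PowerSeries
D X? Y? n = fromℕℚ (totalDescents X? Y? n)

-- Mark descents by y. Let F a be the generating function of the words that may
-- follow a letter a which differs from its predecessor, and H a of those that may
-- follow a repeated letter a. Reading one more letter gives
--   H a = 1 + x F (a+1),   F a = 1 + x (y Σ_{b<a} F b + H a + F (a+1)),
-- and this system determines all coefficients. It is solved by the geometric
-- sequence F a = (1+x) U (1+xyU)ᵃ, where U = 1 + x(1+x)U(1+xyU).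
-- Differentiating at y = 1, with U′ = ∂U/∂y, gives D = x(1+x)U′. Finally 1 − x − x² − 2x²(1+x)U squares to
-- 1 − 2x − 5x² − 2x³ + x⁴, and its product with U′ is x²(1+x)U².
module Submission where

open import Defs
open import Algebra.Bundles using (CommutativeRing)
import Algebra.Construct.Pointwise as Pointwise
import Algebra.Solver.Ring
open import Algebra.Solver.Ring.AlmostCommutativeRing
  using (fromCommutativeRing; _-Raw-AlmostCommutative⟶_)
open import Data.Bool using (if_then_else_; true; false)
open import Data.Fin using (toℕ)
open import Data.Fin.Properties using (toℕ<n)
open import Data.Integer as ℤ using (+_; -[1+_])
import Data.Integer.Properties as ℤ
open import Data.List using (List; []; _∷_; _++_; map; concatMap; filter; upTo)
open import Data.List.Properties using (map-++; map-∘; filter-++; upTo-∷ʳ)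
open import Data.Maybe using (Maybe)
open import Data.Nat as ℕ using (ℕ; zero; suc; _≤_; _<_; _≥_; _≟_; _≥?_; z≤n; s≤s)
open import Data.Nat.Coprimality using (1-coprimeTo) renaming (sym to coprime-sym)
open import Data.Nat.GeneralisedArithmetic using (fold)
open import Data.Nat.ListAction using (sum)
open import Data.Nat.ListAction.Properties using (sum-++)
import Data.Nat.Properties as ℕ
import Data.Nat.Solver as ℕ
open import Data.Product using (_,_)
open import Data.Rational as ℚ using (ℚ; mkℚ; 0ℚ; 1ℚ; ½; _/_)
import Data.Rational.Properties as ℚ
open import Algebra.Properties.Semiring.Sum (CommutativeRing.semiring ℚ.+-*-commutativeRing)
  using (sum-cong-≗)
open import Data.Rational.Solver using (module +-*-Solver)
open import Function using (_∘_; _⇔_; mk⇔)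
open import Level using (0ℓ)
open import Relation.Binary.PropositionalEquality
  using (_≡_; _≗_; _≢_; refl; sym; trans; cong; cong₂; module ≡-Reasoning)
open import Relation.Nullary using (¬_; Dec; does)
open import Relation.Nullary.Decidable using (dec⇒maybe; map′; does-⇔; dec-true; dec-false)

-- The ring of formal power series and a ring solver for it.

infix 8 -ₛ_

0ₛ : PowerSeries
0ₛ _ = 0ℚ

-ₛ_ : PowerSeries → PowerSeries
(-ₛ f) n = ℚ.- f n

constant : ℚ → PowerSeries
constant c zero    = c
constant c (suc _) = 0ℚ

tail : PowerSeries → PowerSeries
tail f = f ∘ suc

*-zero : ∀ f g → (f * g) 0 ≡ f 0 ℚ.* g 0
*-zero f g = ℚ.+-identityʳ _

*-cong : ∀ {f f′ g g′} → f ≗ f′ → g ≗ g′ → f * g ≗ f′ * g′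
*-cong f≗ g≗ n = sum-cong-≗ {suc n} λ i → cong₂ ℚ._*_ (f≗ (toℕ i)) (g≗ (n ℕ.∸ toℕ i))

-- The product unfolds by definition at the constant term of its left factor. Splitting at the right
-- factor instead gives the mirrored recurrence, and matching the two proves `*-comm`.
*-suc′ : ∀ f g n → (f * g) (suc n) ≡ f (suc n) ℚ.* g 0 ℚ.+ (f * tail g) n
*-suc′ f g zero =
  solve 4 (λ a b c d → a :* b :+ (c :* d :+ con 0ℚ) := c :* d :+ (a :* b :+ con 0ℚ)) refl
    (f 0) (g 1) (f 1) (g 0)
  where open +-*-Solver
*-suc′ f g (suc n) = trans
  (cong (f 0 ℚ.* g (suc (suc n)) ℚ.+_) (*-suc′ (tail f) g n))
  (solve 3 (λ a b c → a :+ (b :+ c) := b :+ (a :+ c)) refl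
    (f 0 ℚ.* g (suc (suc n))) (f (suc (suc n)) ℚ.* g 0) ((tail f * tail g) n))
  where open +-*-Solver

*-comm : ∀ f g → f * g ≗ g * f
*-comm f g zero    = cong (ℚ._+ 0ℚ) (ℚ.*-comm (f 0) (g 0))
*-comm f g (suc n) = trans (*-suc′ f g n)
  (cong₂ ℚ._+_ (ℚ.*-comm (f (suc n)) (g 0)) (*-comm f (tail g) n))

*-distribʳ-+ : ∀ h f g → (f + g) * h ≗ f * h + g * h
*-distribʳ-+ h f g zero =
  solve 3 (λ a b c → (a :+ b) :* c :+ con 0ℚ := (a :* c :+ con 0ℚ) :+ (b :* c :+ con 0ℚ)) refl
    (f 0) (g 0) (h 0)
  where open +-*-Solver
*-distribʳ-+ h f g (suc n) = trans
  (cong ((f 0 ℚ.+ g 0) ℚ.* h (suc n) ℚ.+_) (*-distribʳ-+ h (tail f) (tail g) n))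
  (solve 5 (λ a b c d e → (a :+ b) :* c :+ (d :+ e) := (a :* c :+ d) :+ (b :* c :+ e)) refl
    (f 0) (g 0) (h (suc n)) ((tail f * h) n) ((tail g * h) n))
  where open +-*-Solver

scale : ℚ → PowerSeries → PowerSeries
scale c f n = c ℚ.* f n

scale-* : ∀ c f g → scale c f * g ≗ scale c (f * g)
scale-* c f g zero =
  solve 3 (λ a b c → (a :* b) :* c :+ con 0ℚ := a :* (b :* c :+ con 0ℚ)) refl c (f 0) (g 0)
  where open +-*-Solver
scale-* c f g (suc n) = trans
  (cong (c ℚ.* f 0 ℚ.* g (suc n) ℚ.+_) (scale-* c (tail f) g n))
  (solve 4 (λ a b c d → a :* b :* c :+ a :* d := a :* (b :* c :+ d)) refl
    c (f 0) (g (suc n)) ((tail f * g) n))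
  where open +-*-Solver

*-assoc : ∀ f g h → (f * g) * h ≗ f * (g * h)
*-assoc f g h zero =
  solve 3 (λ a b c → (a :* b :+ con 0ℚ) :* c :+ con 0ℚ := a :* (b :* c :+ con 0ℚ) :+ con 0ℚ) refl
    (f 0) (g 0) (h 0)
  where open +-*-Solver
*-assoc f g h (suc n) = begin
  -- By definition `tail (f * g)` is `scale (f 0) (tail g) + tail f * g`, so the induction
  -- hypothesis is applied to `tail f`.
  (f * g) 0 ℚ.* h (suc n) ℚ.+ ((scale (f 0) (tail g) + tail f * g) * h) n
    ≡⟨ cong₂ ℚ._+_ (cong (ℚ._* h (suc n)) (*-zero f g)) (trans
         (*-distribʳ-+ h (scale (f 0) (tail g)) (tail f * g) n)
         (cong₂ ℚ._+_ (scale-* (f 0) (tail g) h n) (*-assoc (tail f) g h n))) ⟩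
  f 0 ℚ.* g 0 ℚ.* h (suc n) ℚ.+ (f 0 ℚ.* (tail g * h) n ℚ.+ (tail f * (g * h)) n)
    ≡⟨ solve 5 (λ a b c d e → a :* b :* c :+ (a :* d :+ e) := a :* (b :* c :+ d) :+ e) refl
         (f 0) (g 0) (h (suc n)) ((tail g * h) n) ((tail f * (g * h)) n) ⟩
  f 0 ℚ.* (g * h) (suc n) ℚ.+ (tail f * (g * h)) n ∎
  where
  open ≡-Reasoning
  open +-*-Solver

*-zeroˡ : ∀ f → 0ₛ * f ≗ 0ₛ
*-zeroˡ f zero    = trans (*-zero 0ₛ f) (ℚ.*-zeroˡ (f 0))
*-zeroˡ f (suc n) = cong₂ ℚ._+_ (ℚ.*-zeroˡ (f (suc n))) (*-zeroˡ f n)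

constant-* : ∀ c f → constant c * f ≗ scale c f
constant-* c f zero    = *-zero (constant c) f
constant-* c f (suc n) = trans
  (cong (c ℚ.* f (suc n) ℚ.+_) (*-zeroˡ f n))
  (ℚ.+-identityʳ _)

1ₛ≗constant : 1ₛ ≗ constant 1ℚ
1ₛ≗constant zero    = refl
1ₛ≗constant (suc _) = refl

*-identityˡ : ∀ f → 1ₛ * f ≗ f
*-identityˡ f n = trans (*-cong {g = f} 1ₛ≗constant (λ _ → refl) n)
  (trans (constant-* 1ℚ f n) (ℚ.*-identityˡ (f n)))

x-*-suc : ∀ f n → (x * f) (suc n) ≡ f n
x-*-suc f n = trans (cong₂ ℚ._+_ (ℚ.*-zeroˡ (f (suc n))) (*-cong {g = f} tail-x (λ _ → refl) n))
  (trans (ℚ.+-identityˡ ((1ₛ * f) n)) (*-identityˡ f n))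
  where
  tail-x : tail x ≗ 1ₛ
  tail-x zero    = refl
  tail-x (suc _) = refl

powerSeries-commutativeRing : CommutativeRing 0ℓ 0ℓ
powerSeries-commutativeRing = record
  { Carrier = PowerSeries ; _≈_ = _≗_
  ; _+_ = _+_ ; _*_ = _*_ ; -_ = -ₛ_ ; 0# = 0ₛ ; 1# = 1ₛ
  ; isCommutativeRing = record
    { isRing = record
      { +-isAbelianGroup = Pointwise.isAbelianGroup ℕ ℚ.+-0-isAbelianGroup
      ; *-cong     = *-cong
      ; *-assoc    = *-assoc
      ; *-identity = *-identityˡ , λ f n → trans (*-comm f 1ₛ n) (*-identityˡ f n)
      ; distrib    = (λ f g h n → trans (*-comm f (g + h) n) (trans (*-distribʳ-+ f g h n)
                       (cong₂ ℚ._+_ (*-comm g f n) (*-comm h f n))))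
                   , *-distribʳ-+
      }
    ; *-comm = *-comm
    }
  }

-- Equal to constant, but with 0ₛ and 1ₛ as values at 0ℚ and 1ℚ definitionally,
-- so that the solver's constants unify with them.
coefficient : ℚ → PowerSeries
coefficient (mkℚ (+ 0) 0 _) = 0ₛ
coefficient (mkℚ (+ 1) 0 _) = 1ₛ
coefficient c               = constant c

coefficient-constant : ∀ c → coefficient c ≗ constant c
coefficient-constant (mkℚ (+ 0) 0 _)             zero    = refl
coefficient-constant (mkℚ (+ 0) 0 _)             (suc _) = refl
coefficient-constant (mkℚ (+ 0) (suc _) _)       _       = refl
coefficient-constant (mkℚ (+ 1) 0 _)             zero    = refl
coefficient-constant (mkℚ (+ 1) 0 _)             (suc _) = refl
coefficient-constant (mkℚ (+ 1) (suc _) _)       _       = refl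
coefficient-constant (mkℚ (+ (suc (suc _))) _ _) _       = refl
coefficient-constant (mkℚ -[1+ _ ] _ _)          _       = refl

coefficient-* : ∀ c f → coefficient c * f ≗ scale c f
coefficient-* c f n =
  trans (*-cong {g = f} (coefficient-constant c) (λ _ → refl) n) (constant-* c f n)

-- Lets the solver normalise numerals in `ℚ` while its variables range over power series.
coefficient-homomorphism :
  ℚ.+-*-rawRing -Raw-AlmostCommutative⟶ fromCommutativeRing powerSeries-commutativeRing
coefficient-homomorphism = record
  { ⟦_⟧    = coefficient
  ; +-homo = λ c d n → trans (coefficient-constant (c ℚ.+ d) n) (trans (constant-+ c d n)
      (sym (cong₂ ℚ._+_ (coefficient-constant c n) (coefficient-constant d n))))
  ; *-homo = λ c d n → trans (coefficient-constant (c ℚ.* d) n) (trans (scale-constant c d n)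
      (sym (trans (coefficient-* c (coefficient d) n) (cong (c ℚ.*_) (coefficient-constant d n)))))
  ; -‿homo = λ c n → trans (coefficient-constant (ℚ.- c) n) (trans (constant-neg c n)
      (cong ℚ.-_ (sym (coefficient-constant c n))))
  ; 0-homo = λ _ → refl
  ; 1-homo = λ _ → refl
  }
  where
  constant-+ : ∀ c d → constant (c ℚ.+ d) ≗ constant c + constant d
  constant-+ c d zero    = refl
  constant-+ c d (suc _) = refl

  scale-constant : ∀ c d → constant (c ℚ.* d) ≗ scale c (constant d)
  scale-constant c d zero    = refl
  scale-constant c d (suc _) = sym (ℚ.*-zeroʳ c)

  constant-neg : ∀ c → constant (ℚ.- c) ≗ -ₛ constant c
  constant-neg c zero    = refl
  constant-neg c (suc _) = refl

coefficient-≟ : ∀ c d → Maybe (coefficient c ≗ coefficient d)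
coefficient-≟ c d = dec⇒maybe (map′ (λ { refl _ → refl })
  (λ eq → trans (sym (coefficient-constant c 0)) (trans (eq 0) (coefficient-constant d 0)))
  (c ℚ.≟ d))

module ₛ-Solver = Algebra.Solver.Ring ℚ.+-*-rawRing
  (fromCommutativeRing powerSeries-commutativeRing) coefficient-homomorphism coefficient-≟

-- Congruence modulo powers of x, fixed points and cancellation.

record Agree (n : ℕ) (f g : PowerSeries) : Set where
  constructor agree
  field at : ∀ {k} → k < n → f k ≡ g k

open Agree

-- Contraction in the x-adic metric: each application settles one more coefficient.
Contractive : (PowerSeries → PowerSeries) → Set
Contractive Φ = ∀ {n f g} → Agree n f g → Agree (suc n) (Φ f) (Φ g)

agree-refl : ∀ {n} f → Agree n f f
agree-refl _ = agree λ _ → refl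

+-agree : ∀ {n f f′ g g′} → Agree n f f′ → Agree n g g′ → Agree n (f + g) (f′ + g′)
+-agree p q = agree λ k<n → cong₂ ℚ._+_ (at p k<n) (at q k<n)

*-agree : ∀ {n f f′ g g′} → Agree n f f′ → Agree n g g′ → Agree n (f * g) (f′ * g′)
*-agree p q = agree λ {k} k<n → sum-cong-≗ {suc k} λ i → cong₂ ℚ._*_
  (at p (ℕ.<-≤-trans (toℕ<n i) k<n))
  (at q (ℕ.≤-<-trans (ℕ.m∸n≤m k (toℕ i)) k<n))

x-*-zero : ∀ f → (x * f) 0 ≡ 0ℚ
x-*-zero f = trans (*-zero x f) (ℚ.*-zeroˡ (f 0))

x-*-agree : ∀ {n f g} → Agree n f g → Agree (suc n) (x * f) (x * g)
x-*-agree {n} {f} {g} p = agree shifted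
  where
  shifted : ∀ {k} → k < suc n → (x * f) k ≡ (x * g) k
  shifted {zero}  _         = trans (x-*-zero f) (sym (x-*-zero g))
  shifted {suc k} (s≤s k<n) = trans (x-*-suc f k) (trans (at p k<n) (sym (x-*-suc g k)))

agree-pred : ∀ {n f g} → Agree (suc n) f g → Agree n f g
agree-pred p = agree λ k<n → at p (ℕ.m<n⇒m<1+n k<n)

-- For contractive `Φ` the m-th iterate is final below degree m, so coefficient n is read off the
-- first iterate that has settled it, number n + 1.
fix : (PowerSeries → PowerSeries) → PowerSeries
fix Φ n = fold 0ₛ Φ (suc n) n

fix-unfold : ∀ {Φ} → Contractive Φ → fix Φ ≗ Φ (fix Φ)
-- `fix Φ n` unfolds to `Φ (fold 0ₛ Φ n) n`, and iterate n agrees with `fix Φ` below n.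
fix-unfold {Φ} contractive n = at (contractive fold-fix) ℕ.≤-refl
  where
  fold-agree : ∀ {m n} → m ≤ n → Agree m (fold 0ₛ Φ m) (fold 0ₛ Φ n)
  fold-agree z≤n       = agree λ ()
  fold-agree (s≤s m≤n) = contractive (fold-agree m≤n)

  fold-fix : Agree n (fold 0ₛ Φ n) (fix Φ)
  fold-fix = agree λ k<n → sym (at (fold-agree k<n) ℕ.≤-refl)

-- If `g` vanishes below degree n, then coefficient n of `f * g` is `f 0` times `g n`, which is
-- `g n`; so vanishing climbs one degree at a time.
*-cancelˡ-zero : ∀ f g → f 0 ≡ 1ℚ → f * g ≗ 0ₛ → g ≗ 0ₛ
*-cancelˡ-zero f g f₀≡1 fg≗0 n = at (vanish (suc n)) ℕ.≤-refl
  where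
  open ≡-Reasoning
  leading : ∀ n → Agree n g 0ₛ → (f * g) n ≡ g n
  leading zero    g≈0 = trans (*-zero f g) (trans (cong (ℚ._* g 0) f₀≡1) (ℚ.*-identityˡ (g 0)))
  leading (suc n) g≈0 = begin
    f 0 ℚ.* g (suc n) ℚ.+ (tail f * g) n
      ≡⟨ cong₂ (λ a b → a ℚ.* g (suc n) ℚ.+ b) f₀≡1
           (trans (at (*-agree (agree-refl (tail f)) g≈0) ℕ.≤-refl)
                  (trans (*-comm (tail f) 0ₛ n) (*-zeroˡ (tail f) n))) ⟩
    1ℚ ℚ.* g (suc n) ℚ.+ 0ℚ
      ≡⟨ ℚ.+-identityʳ _ ⟩
    1ℚ ℚ.* g (suc n)
      ≡⟨ ℚ.*-identityˡ _ ⟩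
    g (suc n) ∎

  vanish : ∀ n → Agree n g 0ₛ
  vanish zero    = agree λ ()
  vanish (suc n) = agree λ {k} k<1+n → trans
    (sym (leading k (agree λ j<k → at (vanish n) (ℕ.<-≤-trans j<k (ℕ.s≤s⁻¹ k<1+n)))))
    (fg≗0 k)

-- Uniqueness of the square root.

open CommutativeRing powerSeries-commutativeRing
  using (setoid; +-cong; +-congʳ; +-congˡ; *-congʳ; *-congˡ)

-ₛ-cong : ∀ {f f′ g g′} → f ≗ f′ → g ≗ g′ → f - g ≗ f′ - g′
-ₛ-cong f≗ g≗ n = cong₂ ℚ._-_ (f≗ n) (g≗ n)

•-coefficient : ∀ k f → k • f ≗ coefficient (fromℕℚ k) * f
•-coefficient k f n = sym (coefficient-* (fromℕℚ k) f n)

≗-refl : ∀ {f : PowerSeries} → f ≗ f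
≗-refl _ = refl

module _ where
  open import Relation.Binary.Reasoning.Setoid setoid
  open ₛ-Solver

  -- The product of (s + g)/2 and s - g is zero. Halving gives the first factor constant term 1, so
  -- it cancels.
  sqrt-unique : ∀ f g → g 0 ≡ 1ℚ → g * g ≗ f → sqrt f ≗ g
  sqrt-unique f g g₀≡1 g²≗f = begin
    s             ≈⟨ solve 2 (λ s g → s := g :+ (s :- g)) ≗-refl s g ⟩
    g + (s - g)   ≈⟨ +-congˡ {g} difference≗0 ⟩
    g + 0ₛ        ≈⟨ solve 1 (λ g → g :+ con 0ℚ := g) ≗-refl g ⟩
    g             ∎
    where
    s mean : PowerSeries
    s = sqrt f
    mean = coefficient ½ * (s + g)

    f₀≡1 : f 0 ≡ 1ℚ
    f₀≡1 = trans (sym (g²≗f 0)) (cong (λ c → c ℚ.* c ℚ.+ 0ℚ) g₀≡1)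

    mean₀≡1 : mean 0 ≡ 1ℚ
    mean₀≡1 = trans (*-zero (coefficient ½) (s + g)) (cong (λ c → ½ ℚ.* (1ℚ ℚ.+ c)) g₀≡1)

    difference≗0 : s - g ≗ 0ₛ
    difference≗0 = *-cancelˡ-zero mean (s - g) mean₀≡1 (begin
      mean * (s - g)
        ≈⟨ solve 2 (λ s g → con ½ :* (s :+ g) :* (s :- g) := con ½ :* (s :* s :- g :* g)) ≗-refl s g ⟩
      coefficient ½ * (s * s - g * g)
        ≈⟨ *-congˡ {coefficient ½} (-ₛ-cong (sqrt-square f f₀≡1) g²≗f) ⟩
      coefficient ½ * (f - f)
        ≈⟨ solve 1 (λ f → con ½ :* (f :- f) := con 0ℚ) ≗-refl f ⟩
      0ₛ ∎)

-- The series at y = 1 and their y-derivatives.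

Step : PowerSeries → PowerSeries
Step f = 1ₛ + x * ((1ₛ + x) * (f * (1ₛ + x * f)))

-- Sealed, so that `U` is an atom known through its equation and never unfolds into the iteration.
abstract
  U : PowerSeries
  U = fix Step

  -- The outer factor `x` covers every occurrence of the unknown and makes `Step` contractive;
  -- `agree-pred` brings the inner `x * f` back to the degree of the other factor.
  U-equation : U ≗ Step U
  U-equation = fix-unfold {Step} λ p → +-agree (agree-refl 1ₛ) (x-*-agree
    (*-agree (agree-refl (1ₛ + x)) (*-agree p (+-agree (agree-refl 1ₛ) (agree-pred (x-*-agree p))))))

-- The y-derivative at y = 1 of U = 1 + x(1+x)U(1+xyU), with f in the place of U′.
Step′ : PowerSeries → PowerSeries
Step′ f = x * ((1ₛ + x) * (f * (1ₛ + x * U) + U * (x * U + x * f)))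

abstract
  U′ : PowerSeries
  U′ = fix Step′

  U′-equation : U′ ≗ Step′ U′
  U′-equation = fix-unfold {Step′} λ p → x-*-agree (*-agree (agree-refl (1ₛ + x)) (+-agree
    (*-agree p (agree-refl (1ₛ + x * U)))
    (*-agree (agree-refl U) (+-agree (agree-refl (x * U)) (agree-pred (x-*-agree p))))))

-- `U` is a root of the quadratic x²(1+x)u² - Pu + 1 in u, and `S` is minus the derivative of that
-- quadratic at `U`.
P S : PowerSeries
P = 1ₛ - x - x * x
S = P - coefficient (fromℕℚ 2) * (x * x * ((1ₛ + x) * U))

radicand : PowerSeries
radicand = 1ₛ - 2 • x - 5 • x ^ 2 - 2 • x ^ 3 + x ^ 4

partialSum : (ℕ → PowerSeries) → ℕ → PowerSeries
partialSum f zero    = 0ₛ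
partialSum f (suc a) = partialSum f a + f a

ρ ρ′ : PowerSeries
ρ  = 1ₛ + x * U
ρ′ = x * U + x * U′

-- The y-derivative of (1 + xyU)ᵃ at y = 1, by the product rule along the recursion of `_^_`.
ρ^′ : ℕ → PowerSeries
ρ^′ zero    = 0ₛ
ρ^′ (suc a) = ρ * ρ^′ a + ρ′ * ρ ^ a

-- The series F, H and, primed, their y-derivatives, all at y = 1.
F F′ H H′ : ℕ → PowerSeries
F a  = (1ₛ + x) * (U * ρ ^ a)
F′ a = (1ₛ + x) * (U′ * ρ ^ a + U * ρ^′ a)
H a  = 1ₛ + x * F (suc a)
H′ a = x * F′ (suc a)

-- The closed form and the functional equations.

module _ where
  open import Relation.Binary.Reasoning.Setoid setoid
  open ₛ-Solver

  -- The linear terms of the equation for `U` are collected: 1 - x(1+x) is `P`.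
  U-root : P * U - x * (x * ((1ₛ + x) * (U * U))) ≗ 1ₛ
  U-root = begin
    P * U - x * (x * ((1ₛ + x) * (U * U)))
      ≈⟨ solve 2 (λ x u → (con 1ℚ :- x :- x :* x) :* u :- x :* (x :* ((con 1ℚ :+ x) :* (u :* u)))
           := u :- x :* ((con 1ℚ :+ x) :* (u :* (con 1ℚ :+ x :* u))))
           ≗-refl x U ⟩
    U - x * ((1ₛ + x) * (U * (1ₛ + x * U)))
      ≈⟨ -ₛ-cong U-equation ≗-refl ⟩
    Step U - x * ((1ₛ + x) * (U * (1ₛ + x * U)))
      ≈⟨ solve 1 (λ t → con 1ℚ :+ t :- t := con 1ℚ) ≗-refl (x * ((1ₛ + x) * (U * (1ₛ + x * U)))) ⟩
    1ₛ ∎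

  -- Completing the square: by `U-root`, S² is the discriminant P² - 4x²(1+x).
  S-square : S * S ≗ radicand
  S-square = begin
    S * S
      ≈⟨ solve 2 (λ x u →
           (con 1ℚ :- x :- x :* x :- con (fromℕℚ 2) :* (x :* x :* ((con 1ℚ :+ x) :* u)))
           :* (con 1ℚ :- x :- x :* x :- con (fromℕℚ 2) :* (x :* x :* ((con 1ℚ :+ x) :* u)))
           := (con 1ℚ :- x :- x :* x) :* (con 1ℚ :- x :- x :* x)
              :- con (fromℕℚ 4) :* (x :* x :* (con 1ℚ :+ x))
                 :* ((con 1ℚ :- x :- x :* x) :* u :- x :* (x :* ((con 1ℚ :+ x) :* (u :* u)))))
           ≗-refl x U ⟩
    P * P - coefficient (fromℕℚ 4) * (x * x * (1ₛ + x)) * (P * U - x * (x * ((1ₛ + x) * (U * U))))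
      ≈⟨ -ₛ-cong (≗-refl {P * P}) (*-congˡ {coefficient (fromℕℚ 4) * (x * x * (1ₛ + x))} U-root) ⟩
    P * P - coefficient (fromℕℚ 4) * (x * x * (1ₛ + x)) * 1ₛ
      -- The trailing `con 1ℚ` factors reproduce how `x ^ k` unfolds, down to `x ^ 0 = 1ₛ`.
      ≈⟨ solve 1 (λ x →
           (con 1ℚ :- x :- x :* x) :* (con 1ℚ :- x :- x :* x)
           :- con (fromℕℚ 4) :* (x :* x :* (con 1ℚ :+ x)) :* con 1ℚ
           := con 1ℚ :- con (fromℕℚ 2) :* x :- con (fromℕℚ 5) :* (x :* (x :* con 1ℚ))
              :- con (fromℕℚ 2) :* (x :* (x :* (x :* con 1ℚ))) :+ x :* (x :* (x :* (x :* con 1ℚ))))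
           ≗-refl x ⟩
    1ₛ - coefficient (fromℕℚ 2) * x - coefficient (fromℕℚ 5) * x ^ 2
      - coefficient (fromℕℚ 2) * x ^ 3 + x ^ 4
      ≈⟨ +-cong (-ₛ-cong (-ₛ-cong (-ₛ-cong (≗-refl {1ₛ}) (•-coefficient 2 x)) (•-coefficient 5 (x ^ 2)))
           (•-coefficient 2 (x ^ 3))) (≗-refl {x ^ 4}) ⟨
    radicand ∎

  -- Selects the branch: between `S` and its negative, the constant term decides.
  S-zero : S 0 ≡ 1ℚ
  S-zero = cong (λ c → 1ℚ ℚ.- c) (trans
    (*-zero (coefficient (fromℕℚ 2)) (x * x * ((1ₛ + x) * U)))
    (cong (fromℕℚ 2 ℚ.*_) (trans (*-zero (x * x) ((1ₛ + x) * U)) (ℚ.*-zeroˡ (((1ₛ + x) * U) 0)))))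

  sqrt-radicand : sqrt radicand ≗ S
  sqrt-radicand = sqrt-unique radicand S S-zero S-square

  -- The equation for `U′` is linear in `U′`, and 1 minus the coefficient of `U′` on its right side
  -- is x(1+x)(1+2xU) subtracted from 1, that is `S`.
  S-U′ : S * U′ ≗ x * (x * ((1ₛ + x) * (U * U)))
  S-U′ = begin
    S * U′
      ≈⟨ solve 3 (λ x u v →
           (con 1ℚ :- x :- x :* x :- con (fromℕℚ 2) :* (x :* x :* ((con 1ℚ :+ x) :* u))) :* v
           := (v :- x :* ((con 1ℚ :+ x) :* (v :* (con 1ℚ :+ x :* u) :+ u :* (x :* u :+ x :* v))))
              :+ x :* (x :* ((con 1ℚ :+ x) :* (u :* u)))) ≗-refl x U U′ ⟩
    (U′ - Step′ U′) + x * (x * ((1ₛ + x) * (U * U)))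
      ≈⟨ +-congʳ {x * (x * ((1ₛ + x) * (U * U)))} (-ₛ-cong U′-equation (≗-refl {Step′ U′})) ⟩
    (Step′ U′ - Step′ U′) + x * (x * ((1ₛ + x) * (U * U)))
      ≈⟨ solve 2 (λ s t → (s :- s) :+ t := t) ≗-refl (Step′ U′) (x * (x * ((1ₛ + x) * (U * U)))) ⟩
    x * (x * ((1ₛ + x) * (U * U))) ∎

  -- By `S-U′` and `U-root` the left side is 2x²(1+x)(PU - 1). As 2x²(1+x)U is P - S, this equals P²
  -- - 2x²(1+x) - PS, and the first two terms make up the polynomial 1 - 2x - 3x² + x⁴.
  closed-form : ∀ G → G ≗ x * ((1ₛ + x) * U′) →
    2 • x * sqrt radicand * G ≗ 1ₛ - 2 • x - 3 • x ^ 2 + x ^ 4 - (1ₛ - x - x ^ 2) * sqrt radicand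
  closed-form G G≗ = begin
    2 • x * sqrt radicand * G
      ≈⟨ *-cong (*-cong (•-coefficient 2 x) sqrt-radicand) G≗ ⟩
    coefficient (fromℕℚ 2) * x * S * (x * ((1ₛ + x) * U′))
      ≈⟨ solve 3 (λ x s v → con (fromℕℚ 2) :* x :* s :* (x :* ((con 1ℚ :+ x) :* v))
           := con (fromℕℚ 2) :* (x :* x :* (con 1ℚ :+ x)) :* (s :* v)) ≗-refl x S U′ ⟩
    coefficient (fromℕℚ 2) * (x * x * (1ₛ + x)) * (S * U′)
      ≈⟨ *-congˡ {coefficient (fromℕℚ 2) * (x * x * (1ₛ + x))} S-U′ ⟩
    coefficient (fromℕℚ 2) * (x * x * (1ₛ + x)) * (x * (x * ((1ₛ + x) * (U * U))))
      ≈⟨ solve 2 (λ x u → con (fromℕℚ 2) :* (x :* x :* (con 1ℚ :+ x)) :* (x :* (x :* ((con 1ℚ :+ x) :* (u :* u))))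
           := con (fromℕℚ 2) :* (x :* x :* (con 1ℚ :+ x)) :* ((con 1ℚ :- x :- x :* x) :* u
               :- ((con 1ℚ :- x :- x :* x) :* u :- x :* (x :* ((con 1ℚ :+ x) :* (u :* u)))))) ≗-refl x U ⟩
    coefficient (fromℕℚ 2) * (x * x * (1ₛ + x)) * (P * U - (P * U - x * (x * ((1ₛ + x) * (U * U)))))
      ≈⟨ *-congˡ {coefficient (fromℕℚ 2) * (x * x * (1ₛ + x))} (-ₛ-cong (≗-refl {P * U}) U-root) ⟩
    coefficient (fromℕℚ 2) * (x * x * (1ₛ + x)) * (P * U - 1ₛ)
      ≈⟨ solve 2 (λ x u → con (fromℕℚ 2) :* (x :* x :* (con 1ℚ :+ x)) :* ((con 1ℚ :- x :- x :* x) :* u :- con 1ℚ)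
           := con 1ℚ :- con (fromℕℚ 2) :* x :- con (fromℕℚ 3) :* (x :* (x :* con 1ℚ))
              :+ x :* (x :* (x :* (x :* con 1ℚ)))
              :- (con 1ℚ :- x :- x :* (x :* con 1ℚ))
                 :* (con 1ℚ :- x :- x :* x :- con (fromℕℚ 2) :* (x :* x :* ((con 1ℚ :+ x) :* u)))) ≗-refl x U ⟩
    1ₛ - coefficient (fromℕℚ 2) * x - coefficient (fromℕℚ 3) * x ^ 2 + x ^ 4 - (1ₛ - x - x ^ 2) * S
      ≈⟨ -ₛ-cong (+-cong (-ₛ-cong (-ₛ-cong (≗-refl {1ₛ}) (•-coefficient 2 x)) (•-coefficient 3 (x ^ 2)))
           (≗-refl {x ^ 4})) (*-congˡ {1ₛ - x - x ^ 2} sqrt-radicand) ⟨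
    1ₛ - 2 • x - 3 • x ^ 2 + x ^ 4 - (1ₛ - x - x ^ 2) * sqrt radicand ∎

  -- A geometric sum, telescoping because xU = ρ - 1.
  x-partialSum-F : ∀ a → x * partialSum F a ≗ (1ₛ + x) * ρ ^ a - (1ₛ + x)
  x-partialSum-F zero = solve 1 (λ x → x :* con 0ℚ := (con 1ℚ :+ x) :* con 1ℚ :- (con 1ℚ :+ x)) ≗-refl x
  x-partialSum-F (suc a) = begin
    x * (partialSum F a + F a)
      ≈⟨ solve 3 (λ x s f → x :* (s :+ f) := x :* s :+ x :* f) ≗-refl x (partialSum F a) (F a) ⟩
    x * partialSum F a + x * F a
      ≈⟨ +-congʳ {x * F a} (x-partialSum-F a) ⟩
    (1ₛ + x) * ρ ^ a - (1ₛ + x) + x * F a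
      ≈⟨ solve 3 (λ x u p → (con 1ℚ :+ x) :* p :- (con 1ℚ :+ x) :+ x :* ((con 1ℚ :+ x) :* (u :* p))
           := (con 1ℚ :+ x) :* ((con 1ℚ :+ x :* u) :* p) :- (con 1ℚ :+ x)) ≗-refl x U (ρ ^ a) ⟩
    (1ₛ + x) * ρ ^ suc a - (1ₛ + x) ∎

  -- `F b + F′ b` is the y-derivative of yF b at y = 1, so this is the derivative of the geometric
  -- sum with y restored.
  x-partialSum-F′ : ∀ a → x * partialSum (λ b → F b + F′ b) a ≗ (1ₛ + x) * ρ^′ a
  x-partialSum-F′ zero = solve 1 (λ x → x :* con 0ℚ := (con 1ℚ :+ x) :* con 0ℚ) ≗-refl x
  x-partialSum-F′ (suc a) = begin
    x * (Σ + (F a + F′ a))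
      ≈⟨ solve 3 (λ x s f → x :* (s :+ f) := x :* s :+ x :* f) ≗-refl x Σ (F a + F′ a) ⟩
    x * Σ + x * (F a + F′ a)
      ≈⟨ +-congʳ {x * (F a + F′ a)} (x-partialSum-F′ a) ⟩
    (1ₛ + x) * ρ^′ a + x * (F a + F′ a)
      ≈⟨ solve 5 (λ x u v p q →
           (con 1ℚ :+ x) :* q :+ x :* ((con 1ℚ :+ x) :* (u :* p) :+ (con 1ℚ :+ x) :* (v :* p :+ u :* q))
           := (con 1ℚ :+ x) :* ((con 1ℚ :+ x :* u) :* q :+ (x :* u :+ x :* v) :* p))
           ≗-refl x U U′ (ρ ^ a) (ρ^′ a) ⟩
    (1ₛ + x) * ρ^′ (suc a) ∎
    where
    Σ : PowerSeries
    Σ = partialSum (λ b → F b + F′ b) a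

  F-equation : ∀ a → F a ≗ 1ₛ + x * (partialSum F a + H a + F (suc a))
  F-equation a = begin
    F a
      ≈⟨ *-congˡ {1ₛ + x} (*-congʳ {ρ ^ a} U-equation) ⟩
    (1ₛ + x) * (Step U * ρ ^ a)
      -- The 1 + x subtracted from (1+x)ρᵃ is returned as the leading 1 and the x contributed by the
      -- 1 in `H a`.
      ≈⟨ solve 3 (λ x u p →
           (con 1ℚ :+ x) :* ((con 1ℚ :+ x :* ((con 1ℚ :+ x) :* (u :* (con 1ℚ :+ x :* u)))) :* p)
           := con 1ℚ :+ ((con 1ℚ :+ x) :* p :- (con 1ℚ :+ x)
              :+ (x :* (con 1ℚ :+ x :* ((con 1ℚ :+ x) :* (u :* ((con 1ℚ :+ x :* u) :* p))))
              :+ x :* ((con 1ℚ :+ x) :* (u :* ((con 1ℚ :+ x :* u) :* p)))))) ≗-refl x U (ρ ^ a) ⟩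
    1ₛ + ((1ₛ + x) * ρ ^ a - (1ₛ + x) + (x * H a + x * F (suc a)))
      ≈⟨ +-congˡ {1ₛ} (+-congʳ {x * H a + x * F (suc a)} (x-partialSum-F a)) ⟨
    1ₛ + (x * partialSum F a + (x * H a + x * F (suc a)))
      ≈⟨ solve 4 (λ x s h f → con 1ℚ :+ (x :* s :+ (x :* h :+ x :* f)) := con 1ℚ :+ x :* (s :+ h :+ f))
           ≗-refl x (partialSum F a) (H a) (F (suc a)) ⟩
    1ₛ + x * (partialSum F a + H a + F (suc a)) ∎

  -- The y-derivative of the equation for F a; its constant 1 disappears.
  F′-equation : ∀ a → F′ a ≗ x * (partialSum (λ b → F b + F′ b) a + H′ a + F′ (suc a))
  F′-equation a = begin
    F′ a
      ≈⟨ *-congˡ {1ₛ + x} (+-cong (*-congʳ {ρ ^ a} U′-equation) (*-congʳ {ρ^′ a} U-equation)) ⟩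
    (1ₛ + x) * (Step′ U′ * ρ ^ a + Step U * ρ^′ a)
      ≈⟨ solve 5 (λ x u v p q →
           (con 1ℚ :+ x) :* (x :* ((con 1ℚ :+ x) :* (v :* (con 1ℚ :+ x :* u) :+ u :* (x :* u :+ x :* v))) :* p
             :+ (con 1ℚ :+ x :* ((con 1ℚ :+ x) :* (u :* (con 1ℚ :+ x :* u)))) :* q)
           := (con 1ℚ :+ x) :* q :+ (con 1ℚ :+ x) :* (x :* ((con 1ℚ :+ x) :* (v :* ((con 1ℚ :+ x :* u) :* p)
                :+ u :* ((con 1ℚ :+ x :* u) :* q :+ (x :* u :+ x :* v) :* p)))))
           ≗-refl x U U′ (ρ ^ a) (ρ^′ a) ⟩
    (1ₛ + x) * ρ^′ a + (1ₛ + x) * (x * F′ (suc a))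
      ≈⟨ +-congʳ {(1ₛ + x) * (x * F′ (suc a))} (x-partialSum-F′ a) ⟨
    x * Σ + (1ₛ + x) * (x * F′ (suc a))
      ≈⟨ solve 3 (λ x s f → x :* s :+ (con 1ℚ :+ x) :* (x :* f) := x :* (s :+ x :* f :+ f))
           ≗-refl x Σ (F′ (suc a)) ⟩
    x * (Σ + H′ a + F′ (suc a)) ∎
    where
    Σ : PowerSeries
    Σ = partialSum (λ b → F b + F′ b) a

-- Sums of natural numbers as rational coefficients.

fromℕℚ-+ : ∀ m n → fromℕℚ (m ℕ.+ n) ≡ fromℕℚ m ℚ.+ fromℕℚ n
fromℕℚ-+ m n = sym (trans (cong₂ ℚ._+_ (fromℕℚ-mkℚ m) (fromℕℚ-mkℚ n))
  (cong (_/ 1) (cong₂ ℤ._+_ (ℤ.*-identityʳ (+ m)) (ℤ.*-identityʳ (+ n)))))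
  where
  -- For a variable `k` the gcd normalisation in `+ k / 1` is stuck; with both summands in the form
  -- `mkℚ`, rational addition unfolds.
  fromℕℚ-mkℚ : ∀ k → fromℕℚ k ≡ mkℚ (+ k) 0 (coprime-sym (1-coprimeTo k))
  fromℕℚ-mkℚ k = ℚ.↥p/↧p≡p (mkℚ (+ k) 0 (coprime-sym (1-coprimeTo k)))

sum-upTo-suc : ∀ (h : ℕ → ℕ) n → sum (map h (upTo (suc n))) ≡ sum (map h (upTo n)) ℕ.+ h n
sum-upTo-suc h n = begin
  sum (map h (upTo (suc n)))         ≡⟨ cong (λ bs → sum (map h bs)) (upTo-∷ʳ n) ⟨
  sum (map h (upTo n ++ n ∷ []))     ≡⟨ cong sum (map-++ h (upTo n) (n ∷ [])) ⟩
  sum (map h (upTo n) ++ h n ∷ [])   ≡⟨ sum-++ (map h (upTo n)) (h n ∷ []) ⟩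
  sum (map h (upTo n)) ℕ.+ (h n ℕ.+ 0) ≡⟨ cong (sum (map h (upTo n)) ℕ.+_) (ℕ.+-identityʳ (h n)) ⟩
  sum (map h (upTo n)) ℕ.+ h n ∎
  where open ≡-Reasoning

partialSum-upTo : ∀ (h : ℕ → ℕ) f n a → (∀ b → b < a → fromℕℚ (h b) ≡ f b n) →
                  fromℕℚ (sum (map h (upTo a))) ≡ partialSum f a n
partialSum-upTo h f n zero    h≡f = refl
partialSum-upTo h f n (suc a) h≡f = begin
  fromℕℚ (sum (map h (upTo (suc a))))             ≡⟨ cong fromℕℚ (sum-upTo-suc h a) ⟩
  fromℕℚ (sum (map h (upTo a)) ℕ.+ h a)           ≡⟨ fromℕℚ-+ (sum (map h (upTo a))) (h a) ⟩
  fromℕℚ (sum (map h (upTo a))) ℚ.+ fromℕℚ (h a)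
    ≡⟨ cong₂ ℚ._+_ (partialSum-upTo h f n a λ b b<a → h≡f b (ℕ.m<n⇒m<1+n b<a)) (h≡f a ℕ.≤-refl) ⟩
  partialSum f a n ℚ.+ f a n ∎
  where open ≡-Reasoning

-- Weighted enumeration of avoiding words.

Avoiding : Word → Set
Avoiding = Avoids _≡_ _≥_

avoiding? : ∀ w → Dec (Avoiding w)
avoiding? = avoids? _≟_ _≥?_

-- One functional for both systems: `one` gives the counts behind F and H, `des` the totals behind
-- F′ and H′.
weigh : (Word → ℕ) → List Word → ℕ
weigh φ ws = sum (map φ (filter avoiding? ws))

weigh-++ : ∀ φ vs ws → weigh φ (vs ++ ws) ≡ weigh φ vs ℕ.+ weigh φ ws
weigh-++ φ vs ws = begin
  sum (map φ (filter avoiding? (vs ++ ws)))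
    ≡⟨ cong (λ us → sum (map φ us)) (filter-++ avoiding? vs ws) ⟩
  sum (map φ (filter avoiding? vs ++ filter avoiding? ws))
    ≡⟨ cong sum (map-++ φ (filter avoiding? vs) (filter avoiding? ws)) ⟩
  sum (map φ (filter avoiding? vs) ++ map φ (filter avoiding? ws))
    ≡⟨ sum-++ (map φ (filter avoiding? vs)) (map φ (filter avoiding? ws)) ⟩
  weigh φ vs ℕ.+ weigh φ ws ∎
  where open ≡-Reasoning

-- Serves to delete leading letters that do not affect avoidance; a separate `ψ` allows for a
-- descent lost in the deletion.
weigh-transfer : ∀ φ ψ {f g : Word → Word} → (∀ w → Avoiding (f w) ⇔ Avoiding (g w)) →
  (∀ w → φ (f w) ≡ ψ (g w)) → ∀ ws → weigh φ (map f ws) ≡ weigh ψ (map g ws)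
weigh-transfer φ ψ         f⇔g φ≡ψ []       = refl
weigh-transfer φ ψ {f} {g} f⇔g φ≡ψ (w ∷ ws)
  rewrite does-⇔ (f⇔g w) (avoiding? (f w)) (avoiding? (g w))
  with does (avoiding? (g w))
... | true  = cong₂ ℕ._+_ (φ≡ψ w) (weigh-transfer φ ψ f⇔g φ≡ψ ws)
... | false = weigh-transfer φ ψ f⇔g φ≡ψ ws

weigh-none : ∀ φ {f : Word → Word} → (∀ w → ¬ Avoiding (f w)) → ∀ ws → weigh φ (map f ws) ≡ 0
weigh-none φ     ¬f []       = refl
weigh-none φ {f} ¬f (w ∷ ws) rewrite dec-false (avoiding? (f w)) (¬f w) = weigh-none φ ¬f ws

weigh-sum : ∀ φ ψ ws → weigh (λ w → φ w ℕ.+ ψ w) ws ≡ weigh φ ws ℕ.+ weigh ψ ws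
weigh-sum φ ψ ws = go (filter avoiding? ws)
  where
  open ℕ.+-*-Solver
  go : ∀ us → sum (map (λ w → φ w ℕ.+ ψ w) us) ≡ sum (map φ us) ℕ.+ sum (map ψ us)
  go []       = refl
  go (u ∷ us) rewrite go us =
    solve 4 (λ a b c d → (a :+ b) :+ (c :+ d) := (a :+ c) :+ (b :+ d)) refl
      (φ u) (ψ u) (sum (map φ us)) (sum (map ψ us))

-- The words behind F a and H a. The context stays in front, since the step out of it may be a
-- descent or complete the pattern; `n` counts only the letters after it.
continuations repetitions : ℕ → ℕ → List Word
continuations a n = map (a ∷_) (extensions a n)
repetitions a n = map (λ w → a ∷ a ∷ w) (extensions a n)

one : Word → ℕ
one _ = 1

des-step-≤ : ∀ {a b} w → a ≤ b → des (a ∷ b ∷ w) ≡ des (b ∷ w)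
des-step-≤ {a} {b} w a≤b = cong (λ c → (if c then 1 else 0) ℕ.+ des (b ∷ w)) (dec-false (b ℕ.<? a) (ℕ.≤⇒≯ a≤b))

des-step-> : ∀ {a b} w → b < a → des (a ∷ b ∷ w) ≡ 1 ℕ.+ des (b ∷ w)
des-step-> {a} {b} w b<a =
  cong (λ c → (if c then 1 else 0) ℕ.+ des (b ∷ w)) (dec-true (b ℕ.<? a) b<a)

avoiding-≢ : ∀ {a b} → a ≢ b → ∀ w → Avoiding (a ∷ b ∷ w) ⇔ Avoiding (b ∷ w)
avoiding-≢ a≢b w = mk⇔ (λ av c → av (there c))
  (λ { av (here a≡b _) → a≢b a≡b ; av (there c) → av c })

-- The rise to `b` breaks the pattern at the first position by its second relation, and at the
-- second position by its first.
avoiding-≡< : ∀ {a b} → a < b → ∀ w → Avoiding (a ∷ a ∷ b ∷ w) ⇔ Avoiding (b ∷ w)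
avoiding-≡< a<b w = mk⇔ (λ av c → av (there (there c)))
  (λ { av (here _ a≥b)         → ℕ.<⇒≱ a<b a≥b
     ; av (there (here a≡b _)) → ℕ.<⇒≢ a<b a≡b
     ; av (there (there c))    → av c })

-- Splits by the next letter: smaller, equal, or one larger. The map `f` carries the context, so the
-- split serves both `continuations` and `repetitions`.
weigh-extensions : ∀ φ (f : Word → Word) a n → weigh φ (map f (extensions a (suc n))) ≡
  sum (map (λ b → weigh φ (map (λ w → f (b ∷ w)) (extensions b n))) (upTo a))
  ℕ.+ weigh φ (map (λ w → f (a ∷ w)) (extensions a n))
  ℕ.+ weigh φ (map (λ w → f (suc a ∷ w)) (extensions (suc a) n))
weigh-extensions φ f a n = trans (over (upTo (2 ℕ.+ a)))
  (trans (sum-upTo-suc h (suc a)) (cong (ℕ._+ h (suc a)) (sum-upTo-suc h a)))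
  where
  open ≡-Reasoning
  h : ℕ → ℕ
  h b = weigh φ (map (λ w → f (b ∷ w)) (extensions b n))

  g : ℕ → List Word
  g b = map (b ∷_) (extensions b n)

  over : ∀ bs → weigh φ (map f (concatMap g bs)) ≡ sum (map h bs)
  over []       = refl
  over (b ∷ bs) = begin
    weigh φ (map f (g b ++ concatMap g bs))
      ≡⟨ cong (weigh φ) (map-++ f (g b) (concatMap g bs)) ⟩
    weigh φ (map f (g b) ++ map f (concatMap g bs))
      ≡⟨ weigh-++ φ (map f (g b)) (map f (concatMap g bs)) ⟩
    weigh φ (map f (g b)) ℕ.+ weigh φ (map f (concatMap g bs))
      ≡⟨ cong₂ ℕ._+_ (cong (weigh φ) (sym (map-∘ (extensions b n)))) (over bs) ⟩
    h b ℕ.+ sum (map h bs) ∎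

sum-upTo-zero : ∀ (h : ℕ → ℕ) n → (∀ b → b < n → h b ≡ 0) → sum (map h (upTo n)) ≡ 0
sum-upTo-zero h zero    h≡0 = refl
sum-upTo-zero h (suc n) h≡0 = trans (sum-upTo-suc h n)
  (cong₂ ℕ._+_ (sum-upTo-zero h n λ b b<n → h≡0 b (ℕ.m<n⇒m<1+n b<n)) (h≡0 n ℕ.≤-refl))

-- After a repeated `a`, any next letter at most `a` completes the pattern, so only `suc a`
-- survives.
weigh-repetitions : ∀ φ → (∀ a w → φ (a ∷ a ∷ suc a ∷ w) ≡ φ (suc a ∷ w)) → ∀ a n →
  weigh φ (repetitions a (suc n)) ≡ weigh φ (continuations (suc a) n)
weigh-repetitions φ φ-rise a n = trans (weigh-extensions φ (λ w → a ∷ a ∷ w) a n) (cong₂ ℕ._+_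
  (cong₂ ℕ._+_
    (sum-upTo-zero (λ b → weigh φ (map (λ w → a ∷ a ∷ b ∷ w) (extensions b n))) a
      λ b b<a → weigh-none φ (λ w av → av (here refl (ℕ.<⇒≤ b<a))) (extensions b n))
    (weigh-none φ (λ w av → av (here refl ℕ.≤-refl)) (extensions a n)))
  (weigh-transfer φ φ (avoiding-≡< (ℕ.n<1+n a)) (φ-rise a) (extensions (suc a) n)))

-- Identification of the coefficients, and the conclusion.

fromℕℚ-+₃ : ∀ k m n → fromℕℚ (k ℕ.+ m ℕ.+ n) ≡ fromℕℚ k ℚ.+ fromℕℚ m ℚ.+ fromℕℚ n
fromℕℚ-+₃ k m n = trans (fromℕℚ-+ (k ℕ.+ m) n) (cong (ℚ._+ fromℕℚ n) (fromℕℚ-+ k m))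

1+x-*-suc : ∀ f n → (1ₛ + x * f) (suc n) ≡ f n
1+x-*-suc f n = trans (ℚ.+-identityˡ _) (x-*-suc f n)

1+x-*-zero : ∀ f → (1ₛ + x * f) 0 ≡ 1ℚ
1+x-*-zero f = cong (1ℚ ℚ.+_) (x-*-zero f)

-- Mutual induction on `n` for all letters at once: degree n + 1 of the system refers only to degree
-- n.
count-continuations : ∀ n a → fromℕℚ (weigh one (continuations a n)) ≡ F a n
count-repetitions   : ∀ n a → fromℕℚ (weigh one (repetitions a n)) ≡ H a n

count-continuations zero a =
  sym (trans (F-equation a 0) (1+x-*-zero (partialSum F a + H a + F (suc a))))
count-continuations (suc n) a = begin
  fromℕℚ (weigh one (continuations a (suc n)))
    ≡⟨ cong fromℕℚ (weigh-extensions one (a ∷_) a n) ⟩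
  -- The case of an equal next letter is `repetitions a n` by definition.
  fromℕℚ (sum (map below (upTo a)) ℕ.+ weigh one (repetitions a n) ℕ.+ above)
    ≡⟨ fromℕℚ-+₃ (sum (map below (upTo a))) (weigh one (repetitions a n)) above ⟩
  fromℕℚ (sum (map below (upTo a))) ℚ.+ fromℕℚ (weigh one (repetitions a n)) ℚ.+ fromℕℚ above
    ≡⟨ cong₂ ℚ._+_ (cong₂ ℚ._+_
         (partialSum-upTo below F n a λ b b<a → trans
           (cong fromℕℚ (weigh-transfer one one (avoiding-≢ (ℕ.>⇒≢ b<a)) (λ _ → refl) (extensions b n)))
           (count-continuations n b))
         (count-repetitions n a))
         (trans
           (cong fromℕℚ (weigh-transfer one one (avoiding-≢ (ℕ.<⇒≢ (ℕ.n<1+n a))) (λ _ → refl)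
             (extensions (suc a) n)))
           (count-continuations n (suc a))) ⟩
  (partialSum F a + H a + F (suc a)) n
    ≡⟨ 1+x-*-suc (partialSum F a + H a + F (suc a)) n ⟨
  (1ₛ + x * (partialSum F a + H a + F (suc a))) (suc n)
    ≡⟨ F-equation a (suc n) ⟨
  F a (suc n) ∎
  where
  open ≡-Reasoning
  below : ℕ → ℕ
  below b = weigh one (map (λ w → a ∷ b ∷ w) (extensions b n))
  above : ℕ
  above = weigh one (map (λ w → a ∷ suc a ∷ w) (extensions (suc a) n))

count-repetitions zero    a = sym (1+x-*-zero (F (suc a)))
count-repetitions (suc n) a = begin
  fromℕℚ (weigh one (repetitions a (suc n)))
    ≡⟨ cong fromℕℚ (weigh-repetitions one (λ _ _ → refl) a n) ⟩
  fromℕℚ (weigh one (continuations (suc a) n)) ≡⟨ count-continuations n (suc a) ⟩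
  F (suc a) n                                  ≡⟨ 1+x-*-suc (F (suc a)) n ⟨
  H a (suc n) ∎
  where open ≡-Reasoning

-- The same induction for the derivatives. A step down to `b` adds one descent to every word, which
-- turns F′ b into F b + F′ b.
des-continuations : ∀ n a → fromℕℚ (weigh des (continuations a n)) ≡ F′ a n
des-repetitions   : ∀ n a → fromℕℚ (weigh des (repetitions a n)) ≡ H′ a n

des-continuations zero a = sym (trans (F′-equation a 0)
  (x-*-zero (partialSum (λ b → F b + F′ b) a + H′ a + F′ (suc a))))
des-continuations (suc n) a = begin
  fromℕℚ (weigh des (continuations a (suc n)))
    ≡⟨ cong fromℕℚ (weigh-extensions des (a ∷_) a n) ⟩
  fromℕℚ (sum (map below (upTo a)) ℕ.+ weigh des (repetitions a n) ℕ.+ above)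
    ≡⟨ fromℕℚ-+₃ (sum (map below (upTo a))) (weigh des (repetitions a n)) above ⟩
  fromℕℚ (sum (map below (upTo a))) ℚ.+ fromℕℚ (weigh des (repetitions a n)) ℚ.+ fromℕℚ above
    ≡⟨ cong₂ ℚ._+_ (cong₂ ℚ._+_
         (partialSum-upTo below (λ b → F b + F′ b) n a below≡)
         (des-repetitions n a))
         (trans
           (cong fromℕℚ (weigh-transfer des des (avoiding-≢ (ℕ.<⇒≢ (ℕ.n<1+n a)))
             (λ w → des-step-≤ w (ℕ.n≤1+n a)) (extensions (suc a) n)))
           (des-continuations n (suc a))) ⟩
  (partialSum (λ b → F b + F′ b) a + H′ a + F′ (suc a)) n
    ≡⟨ x-*-suc (partialSum (λ b → F b + F′ b) a + H′ a + F′ (suc a)) n ⟨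
  (x * (partialSum (λ b → F b + F′ b) a + H′ a + F′ (suc a))) (suc n)
    ≡⟨ F′-equation a (suc n) ⟨
  F′ a (suc n) ∎
  where
  open ≡-Reasoning
  below : ℕ → ℕ
  below b = weigh des (map (λ w → a ∷ b ∷ w) (extensions b n))
  above : ℕ
  above = weigh des (map (λ w → a ∷ suc a ∷ w) (extensions (suc a) n))

  below≡ : ∀ b → b < a → fromℕℚ (below b) ≡ (F b + F′ b) n
  below≡ b b<a = begin
    fromℕℚ (below b)
      ≡⟨ cong fromℕℚ (weigh-transfer des (λ w → one w ℕ.+ des w) (avoiding-≢ (ℕ.>⇒≢ b<a))
           (λ w → des-step-> w b<a) (extensions b n)) ⟩
    fromℕℚ (weigh (λ w → one w ℕ.+ des w) (continuations b n))
      ≡⟨ cong fromℕℚ (weigh-sum one des (continuations b n)) ⟩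
    fromℕℚ (weigh one (continuations b n) ℕ.+ weigh des (continuations b n))
      ≡⟨ fromℕℚ-+ (weigh one (continuations b n)) (weigh des (continuations b n)) ⟩
    fromℕℚ (weigh one (continuations b n)) ℚ.+ fromℕℚ (weigh des (continuations b n))
      ≡⟨ cong₂ ℚ._+_ (count-continuations n b) (des-continuations n b) ⟩
    (F b + F′ b) n ∎

-- The only word is `a` twice, where the test `a <ᵇ a` is stuck for a variable `a`.
des-repetitions zero    a = trans
  (cong (λ d → fromℕℚ (d ℕ.+ 0)) (des-step-≤ {a} [] ℕ.≤-refl))
  (sym (x-*-zero (F′ (suc a))))
des-repetitions (suc n) a = begin
  fromℕℚ (weigh des (repetitions a (suc n)))
    ≡⟨ cong fromℕℚ (weigh-repetitions des
         (λ a w → trans (des-step-≤ {a} (suc a ∷ w) ℕ.≤-refl) (des-step-≤ w (ℕ.n≤1+n a))) a n) ⟩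
  fromℕℚ (weigh des (continuations (suc a) n)) ≡⟨ des-continuations n (suc a) ⟩
  F′ (suc a) n                                 ≡⟨ x-*-suc (F′ (suc a)) n ⟨
  H′ a (suc n) ∎
  where open ≡-Reasoning

-- A nonempty Catalan word continues its forced first letter 0, which accounts for the factor `x`.
-- For a = 0 the power of `ρ` is 1 and its derivative 0, leaving (1+x)U′.
D-U′ : D {_≡_} {_≥_} _≟_ _≥?_ ≗ x * ((1ₛ + x) * U′)
D-U′ zero    = sym (x-*-zero ((1ₛ + x) * U′))
D-U′ (suc n) = begin
  fromℕℚ (weigh des (continuations 0 n))   ≡⟨ des-continuations n 0 ⟩
  F′ 0 n
    ≡⟨ solve 3 (λ x u v → (con 1ℚ :+ x) :* (v :* con 1ℚ :+ u :* con 0ℚ) := (con 1ℚ :+ x) :* v)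
         (λ _ → refl) x U U′ n ⟩
  ((1ₛ + x) * U′) n                        ≡⟨ x-*-suc ((1ₛ + x) * U′) n ⟨
  (x * ((1ₛ + x) * U′)) (suc n) ∎
  where
  open ≡-Reasoning
  open ₛ-Solver

corollary3p3 : let R = 1ₛ - 2 • x - 5 • x ^ 2 - 2 • x ^ 3 + x ^ 4
    in 2 • x * sqrt R * D {_≡_} {_≥_} _≟_ _≥?_
    ≗ 1ₛ - 2 • x - 3 • x ^ 2 + x ^ 4 - (1ₛ - x - x ^ 2) * sqrt R
corollary3p3 = closed-form (D _≟_ _≥?_) D-U′
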